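{- There exists a $2$-BSA$(3,c,3,1;\mathrm{IS})$ for any odd integer $c$ with $c\geq 9$.
   Context: $Z_n=\{0,1,\ldots,n-1\}$ denotes the integers modulo $n$. For $(x,y)\in Z_r\times Z_c$, the eight points $(x-1,y)$, $(x+1,y)$, $(x,y-1)$, $(x,y+1)$, $(x-1,y-1)$, $(x-1,y+1)$, $(x+1,y-1)$, $(x+1,y+1)$ (first coordinate reduced modulo $r$, second modulo $c$) are said to be strongly $2$-contiguous to $(x,y)$. A $2$-BSA$(r,c,k,\lambda;\mathrm{IS})$ (two-dimensional balanced sampling plan avoiding strongly $2$-contiguous units) is a pair $(X,\mathcal B)$, where $X=Z_r\times Z_c$ and $\mathcal B$ is a collection of $k$-subsets of $X$, called blocks, such that two strongly $2$-contiguous points never appear together in a block, while any two distinct points that are not strongly $2$-contiguous appear together in exactly $\lambda$ blocks. -}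

module Defs where

open import Data.Fin using (Fin; toℕ)
import Data.Fin.Properties as Fin
open import Data.List using (List; []; _∷_; length; filter)
open import Data.List.Relation.Unary.All using (All)
import Data.List.Membership.Propositional as List
open import Data.Nat using (ℕ; suc; _+_)
open import Data.Nat.DivMod using (_mod_)
open import Data.Product using (_×_; _,_)
open import Data.Product.Properties using (≡-dec)
open import Data.Vec using (Vec)
import Data.Vec.Membership.DecPropositional as DecMembership
open import Data.Vec.Membership.Propositional using (_∈_)
open import Data.Vec.Relation.Unary.Unique.Propositional using (Unique)
open import Relation.Binary.Definitions using (DecidableEquality)
open import Relation.Binary.PropositionalEquality using (_≡_; _≢_)
open import Relation.Nullary using (¬_; Dec; _×-dec_)

Point : ℕ → ℕ → Set
Point r c = Fin r × Fin c

_≟ₚ_ : ∀ {r c} → DecidableEquality (Point r c)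
_≟ₚ_ = ≡-dec Fin._≟_ Fin._≟_

-- i ⁺ and i ⁻ are i + 1 and i - 1 in Z_n; modulo suc n, -1 is n.
infix 8 _⁺ _⁻

_⁺ : ∀ {n} → Fin n → Fin n
_⁺ {suc n} i = (toℕ i + 1) mod suc n

_⁻ : ∀ {n} → Fin n → Fin n
_⁻ {suc n} i = (toℕ i + n) mod suc n

neighbours : ∀ {r c} → Point r c → List (Point r c)
neighbours (x , y) =
  (x ⁻ , y) ∷ (x ⁺ , y) ∷ (x , y ⁻) ∷ (x , y ⁺) ∷
  (x ⁻ , y ⁻) ∷ (x ⁻ , y ⁺) ∷ (x ⁺ , y ⁻) ∷ (x ⁺ , y ⁺) ∷ []

StronglyContiguous : ∀ {r c} → Point r c → Point r c → Set
StronglyContiguous p q = q List.∈ neighbours p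

-- A k-subset, presented by an enumeration of its k distinct elements.  The
-- order is immaterial: blocks are only ever used through membership.
record Block (r c k : ℕ) : Set where
  constructor block
  field
    elements : Vec (Point r c) k
    distinct : Unique elements

open Block public

AppearTogether : ∀ {r c k} → Point r c → Point r c → Block r c k → Set
AppearTogether p q B = p ∈ elements B × q ∈ elements B

appearTogether? : ∀ {r c k} (p q : Point r c) (B : Block r c k) →
                  Dec (AppearTogether p q B)
appearTogether? p q B = (p ∈? elements B) ×-dec (q ∈? elements B)
  where open DecMembership _≟ₚ_ using (_∈?_)

-- The collection of blocks is a multiset (a list up to order), so the number
-- of blocks through a pair is counted with multiplicity.  The condition p ≢ q
-- in `avoiding` matters only if r = 1 or c = 1, where a point is among its own
-- neighbours.
record Is2-BSA-IS (r c k index : ℕ) (blocks : List (Block r c k)) : Set where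
  field
    avoiding : ∀ (p q : Point r c) → p ≢ q → StronglyContiguous p q →
               All (λ B → ¬ AppearTogether p q B) blocks
    balanced : ∀ (p q : Point r c) → p ≢ q → ¬ StronglyContiguous p q →
               length (filter (appearTogether? p q) blocks) ≡ index

{-# OPTIONS --safe #-}
module Submission where

-- Write c = 7 + 2k.  Each of 2 + k pairs (p , d) is developed over Z₃ × Z_c into
-- the blocks {(x , m), (x , m + d), (x + 1, m + d + p)}.  All three rows being
-- mutually adjacent, only column differences 0 and ±1 must be avoided, so every
-- non-contiguous pair of points lies in a block as soon as the ends p, p + d
-- run through 2 , … , c − 2 and so do the differences d , c − d: the pairs form
-- a Langford-type sequence whose differences 2, 4, 3, 5, …, 2k + 1 need
-- only represent 2, 3, …, k + 3 up to sign modulo c.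
--
-- That two points never meet twice, nor when contiguous, and that the points of
-- a block are distinct, follows by counting: the ordered pairs of places in the
-- blocks, together with 9 near pairs per point, map onto the ordered pairs of
-- points, and both sets have (3c)² elements.

open import Defs
open import Data.Fin using (Fin; zero; suc; toℕ; punchIn; punchOut)
open import Data.Fin.Patterns using (0F; 1F; 2F)
open import Data.Fin.Properties as Fin
  using (_≟_; toℕ-injective; toℕ-fromℕ<; toℕ<n; pigeonhole; punchOut-injective; +↔⊎; *↔×)
open import Data.List using (List; []; _∷_; _++_; length; filter; tabulate; lookup)
open import Data.List.Properties using (length-++; filter-accept; filter-reject; filter-none)
open import Data.List.Relation.Unary.All using (All)
import Data.List.Relation.Unary.All.Properties as All
open import Data.List.Relation.Unary.Any as Any using (Any; here; there; index)
open import Data.List.Relation.Unary.Any.Properties using (++⁺ˡ; ++⁺ʳ; lookup-index)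
open import Data.Nat
  using (ℕ; zero; suc; _+_; _*_; _∸_; _≤_; _<_; _≥_; _%_; z≤n; s≤s; s≤s⁻¹; _≤?_)
open import Data.Nat.DivMod
  using (_mod_; m%n<n; m<n⇒m%n≡m; [m+n]%n≡m%n; [m+kn]%n≡m%n; %-distribˡ-+; m%n%n≡m%n; m*n%n≡0)
open import Data.Nat.Properties hiding (_≟_)
open import Data.Nat.Tactic.RingSolver using (solve-∀)
open import Data.Product using (_×_; _,_; proj₁; proj₂; ∃-syntax)
open import Data.Product.Function.NonDependent.Propositional using (_×-↔_)
open import Data.Sum using (_⊎_; inj₁; inj₂; [_,_]′)
open import Data.Sum.Function.Propositional using (_⊎-↔_)
import Data.Vec as Vec
import Data.Vec.Membership.Propositional as Vec
open import Data.Vec.Membership.Propositional.Properties using (∈-tabulate⁺)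
import Data.Vec.Relation.Unary.Any.Properties as VecAny
open import Data.Vec.Relation.Unary.Unique.Propositional.Properties using (tabulate⁺)
open import Function using (_∘_; _↔_; Inverse; Injection)
open import Function.Construct.Composition using (_↔-∘_)
open import Function.Construct.Identity using (↔-id)
open import Function.Construct.Symmetry using (↔-sym)
open import Function.Definitions using (Injective; StrictlySurjective)
open import Function.Properties.Inverse using (↔⇒↣)
open import Relation.Binary.Definitions using (tri<; tri≈; tri>)
open import Relation.Binary.PropositionalEquality hiding ([_])
open import Relation.Nullary using (¬_; yes; no; contradiction)
open import Relation.Nullary.Decidable using (from-no; decidable-stable)
open import Relation.Unary using (Decidable)

pattern #0 x = here x
pattern #1 x = there (#0 x)
pattern #2 x = there (#1 x)
pattern #3 x = there (#2 x)
pattern #4 x = there (#3 x)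
pattern #5 x = there (#4 x)
pattern #6 x = there (#5 x)
pattern #7 x = there (#6 x)

halve : ∀ n → ∃[ m ] (n ≡ 2 * m ⊎ n ≡ 1 + 2 * m)
halve zero = 0 , inj₁ refl
halve (suc n) with halve n
... | m , inj₁ n≡2m   = m , inj₂ (cong suc n≡2m)
... | m , inj₂ n≡1+2m = suc m , inj₁ (trans (cong suc n≡1+2m) (sym (*-suc 2 m)))

-- Langford-type sequences and coverings of intervals.

Base : Set
Base = ℕ × ℕ

-- The two ends are the column offsets of the third point of a block from its second and from its
-- first point; the difference is the offset between those two.
End Difference : ℕ → Base → Set
End        v (p , d) = v ≡ p ⊎ v ≡ d + p
Difference v (p , d) = v ≡ d

Covers : (ℕ → Set) → ℕ → ℕ → Set
Covers P a b = ∀ v → a ≤ v → v < b → P v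

infixr 5 _⌢_

_⌢_ : ∀ {P a b c} → Covers P a b → Covers P b c → Covers P a c
_⌢_ {b = b} f g v a≤v v<c with b ≤? v
... | yes b≤v = g v b≤v v<c
... | no  b≰v = f v a≤v (≰⇒> b≰v)

none : ∀ {P a} → Covers P a a
none v a≤v v<a = contradiction v<a (≤⇒≯ a≤v)

one : ∀ {P a} → P a → Covers P a (suc a)
one {P} x v a≤v v<1+a = subst P (≤-antisym a≤v (s≤s⁻¹ v<1+a)) x

map-Covers : ∀ {P Q a b} → (∀ {v} → P v → Q v) → Covers P a b → Covers Q a b
map-Covers f cov v a≤v v<b = f (cov v a≤v v<b)

-- Upper bounds in `Covers` are exclusive, so with c = 7 + 2k the ends fill 2, ..., c - 2. These are
-- 4 + 2k values, exactly as many as 2 + k pairs have ends. In `odds` the index e < k stands for the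
-- difference 3 + 2e.
record Langford (k : ℕ) : Set where
  field
    pairs : List Base
    size  : length pairs ≡ 2 + k
    ends  : Covers (λ v → Any (End v) pairs) 2 (6 + 2 * k)
    two   : Any (Difference 2) pairs
    four  : Any (Difference 4) pairs
    odds  : Covers (λ e → Any (Difference (3 + 2 * e)) pairs) 0 k

-- s nested pairs with left ends a, …, a + s − 1 and differences 3 + 2x for
-- x = s + e − 1, …, e, so the right ends are consecutive as well.
nest : ℕ → ℕ → ℕ → List Base
nest zero    a e = []
nest (suc s) a e = (a , 3 + 2 * (s + e)) ∷ nest s (suc a) e

length-nest : ∀ s a e → length (nest s a e) ≡ s
length-nest zero    a e = refl
length-nest (suc s) a e = cong suc (length-nest s (suc a) e)

nest-left : ∀ s a e → Covers (λ v → Any (End v) (nest s a e)) a (a + s)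
nest-left zero    a e rewrite +-identityʳ a = none
nest-left (suc s) a e rewrite +-suc a s =
  one (#0 (inj₁ refl)) ⌢ map-Covers there (nest-left s (suc a) e)

-- Each further pair moves the left end up by 1 and shortens the difference by 2, so right ends
-- descend: the head of the list supplies the topmost one. The start `x` is tied by an equation so
-- that callers can write it in the form that chains with the adjacent ranges.
nest-right : ∀ s a e x → x ≡ 2 + (s + (2 * e + a)) →
             Covers (λ v → Any (End v) (nest s a e)) x (x + s)
nest-right zero    a e x eq rewrite +-identityʳ x = none
nest-right (suc s) a e x eq rewrite +-suc x s =
  map-Covers there (nest-right s (suc a) e x (trans eq (lemma₁ s a e)))
  ⌢ one (here (inj₂ (trans (cong (_+ s) eq) (lemma₂ s a e))))
  where
  lemma₁ : ∀ s a e → 2 + (suc s + (2 * e + a)) ≡ 2 + (s + (2 * e + suc a))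
  lemma₁ = solve-∀
  lemma₂ : ∀ s a e → 2 + (suc s + (2 * e + a)) + s ≡ 3 + 2 * (s + e) + a
  lemma₂ = solve-∀

nest-odds : ∀ s a e → Covers (λ x → Any (Difference (3 + 2 * x)) (nest s a e)) e (s + e)
nest-odds zero    a e = none
nest-odds (suc s) a e = map-Covers there (nest-odds s (suc a) e) ⌢ one (#0 refl)

-- The two general families begin at k = 3 and k = 4; the cases c = 9 and c = 11 are given
-- explicitly.
langford-1 : Langford 1
langford-1 = record
  { pairs = (3 , 2) ∷ (2 , 4) ∷ (4 , 3) ∷ []
  ; size  = refl
  ; ends  = one (#1 (inj₁ refl))
          ⌢ one (#0 (inj₁ refl))
          ⌢ one (#2 (inj₁ refl))
          ⌢ one (#0 (inj₂ refl))
          ⌢ one (#1 (inj₂ refl))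
          ⌢ one (#2 (inj₂ refl))
  ; two   = #0 refl
  ; four  = #1 refl
  ; odds  = one (#2 refl)
  }

langford-2 : Langford 2
langford-2 = record
  { pairs = (3 , 2) ∷ (4 , 4) ∷ (6 , 3) ∷ (2 , 5) ∷ []
  ; size  = refl
  ; ends  = one (#3 (inj₁ refl))
          ⌢ one (#0 (inj₁ refl))
          ⌢ one (#1 (inj₁ refl))
          ⌢ one (#0 (inj₂ refl))
          ⌢ one (#2 (inj₁ refl))
          ⌢ one (#3 (inj₂ refl))
          ⌢ one (#1 (inj₂ refl))
          ⌢ one (#2 (inj₂ refl))
  ; two   = #0 refl
  ; four  = #1 refl
  ; odds  = one (#2 refl) ⌢ one (#3 refl)
  }

-- The inner nest uses the odd differences 3, ..., 2s + 1 and the outer nest 2s + 9, ..., 4s + 7.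
-- The single pairs carry the remaining 2, 4, 2s + 3, 2s + 5, 2s + 7 and plug the gaps that the
-- nests leave.
langford-3+2s : ∀ s → Langford (3 + 2 * s)
langford-3+2s s = record
  { pairs = singles ++ inner ++ outer
  ; size  = trans (cong (5 +_) (length-++ inner))
            (trans (cong₂ (λ m n → 5 + (m + n)) (length-nest s _ _) (length-nest s _ _)) (e₀ s))
  -- In increasing order: 2; outer left ends up to s + 2; s + 3, ..., s + 7; inner left ends up to
  -- 2s + 7; 2s + 8, 2s + 9; inner right ends up to 3s + 9; 3s + 10; outer right ends up to 4s + 10;
  -- and 4s + 11 = c - 2.
  ; ends  = one (single (#4 (inj₁ refl)))
          ⌢ map-Covers inOuter (nest-left s 3 (3 + s))
          ⌢ one (single (#1 (inj₁ refl)))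
          ⌢ one (single (#0 (inj₁ refl)))
          ⌢ one (single (#3 (inj₁ refl)))
          ⌢ one (single (#0 (inj₂ refl)))
          ⌢ one (single (#1 (inj₂ refl)))
          ⌢ map-Covers inInner (nest-left s (8 + s) 0)
          ⌢ one (single (#2 (inj₁ refl)))
          ⌢ one (single (#4 (inj₂ (e₁ s))))
          ⌢ map-Covers inInner (nest-right s (8 + s) 0 (10 + (s + s)) (e₂ s))
          ⌢ one (single (#3 (inj₂ (e₃ s))))
          ⌢ map-Covers inOuter (nest-right s 3 (3 + s) (11 + (s + s + s)) (e₄ s))
          ⌢ subst (Covers _ _) (e₆ s) (one (single (#2 (inj₂ (e₅ s)))))
  ; two   = #0 refl
  ; four  = #1 refl
  ; odds  = subst (Covers _ 0) (+-identityʳ s) (map-Covers inInner (nest-odds s (8 + s) 0))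
          ⌢ one (single (#2 refl))
          ⌢ one (single (#3 refl))
          ⌢ one (single (#4 refl))
          ⌢ subst (Covers _ _) (e₇ s) (map-Covers inOuter (nest-odds s 3 (3 + s)))
  }
  where
  singles inner outer : List Base
  singles = (4 + s , 2) ∷ (3 + s , 4) ∷ (8 + (s + s) , 3 + 2 * s)
          ∷ (5 + s , 3 + 2 * (1 + s)) ∷ (2 , 3 + 2 * (2 + s)) ∷ []
  inner = nest s (8 + s) 0
  outer = nest s 3 (3 + s)
  single : ∀ {P : Base → Set} → Any P singles → Any P (singles ++ inner ++ outer)
  single = ++⁺ˡ
  inInner : ∀ {P : Base → Set} → Any P inner → Any P (singles ++ inner ++ outer)
  inInner = ++⁺ʳ singles ∘ ++⁺ˡ
  inOuter : ∀ {P : Base → Set} → Any P outer → Any P (singles ++ inner ++ outer)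
  inOuter = ++⁺ʳ singles ∘ ++⁺ʳ inner
  e₀ : ∀ s → 5 + (s + s) ≡ 2 + (3 + 2 * s)
  e₀ = solve-∀
  e₁ : ∀ s → 9 + (s + s) ≡ 3 + 2 * (2 + s) + 2
  e₁ = solve-∀
  e₂ : ∀ s → 10 + (s + s) ≡ 2 + (s + (2 * 0 + (8 + s)))
  e₂ = solve-∀
  e₃ : ∀ s → 10 + (s + s + s) ≡ 3 + 2 * (1 + s) + (5 + s)
  e₃ = solve-∀
  e₄ : ∀ s → 11 + (s + s + s) ≡ 2 + (s + (2 * (3 + s) + 3))
  e₄ = solve-∀
  e₅ : ∀ s → 11 + (s + s + s + s) ≡ 3 + 2 * s + (8 + (s + s))
  e₅ = solve-∀
  e₆ : ∀ s → 12 + (s + s + s + s) ≡ 6 + 2 * (3 + 2 * s)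
  e₆ = solve-∀
  e₇ : ∀ s → s + (3 + s) ≡ 3 + 2 * s
  e₇ = solve-∀

-- The same pattern with one more single pair, of difference 2s + 9, between the nests; the outer
-- nest now uses 2s + 11, ..., 4s + 9.
langford-4+2s : ∀ s → Langford (4 + 2 * s)
langford-4+2s s = record
  { pairs = singles ++ inner ++ outer
  ; size  = trans (cong (6 +_) (length-++ inner))
            (trans (cong₂ (λ m n → 6 + (m + n)) (length-nest s _ _) (length-nest s _ _)) (e₀ s))
  -- In increasing order: 2; outer left ends up to s + 2; s + 3, ..., s + 8; inner left ends up to
  -- 2s + 8; 2s + 9, 2s + 10; inner right ends up to 3s + 10; 3s + 11, 3s + 12; outer right ends up
  -- to 4s + 12; and 4s + 13 = c - 2.
  ; ends  = one (single (#4 (inj₁ refl)))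
          ⌢ map-Covers inOuter (nest-left s 3 (4 + s))
          ⌢ one (single (#5 (inj₁ refl)))
          ⌢ one (single (#1 (inj₁ refl)))
          ⌢ one (single (#0 (inj₁ refl)))
          ⌢ one (single (#3 (inj₁ refl)))
          ⌢ one (single (#0 (inj₂ refl)))
          ⌢ one (single (#1 (inj₂ refl)))
          ⌢ map-Covers inInner (nest-left s (9 + s) 0)
          ⌢ one (single (#4 (inj₂ (e₁ s))))
          ⌢ one (single (#2 (inj₁ refl)))
          ⌢ map-Covers inInner (nest-right s (9 + s) 0 (11 + (s + s)) (e₂ s))
          ⌢ one (single (#3 (inj₂ (e₃ s))))
          ⌢ one (single (#5 (inj₂ (e₈ s))))
          ⌢ map-Covers inOuter (nest-right s 3 (4 + s) (13 + (s + s + s)) (e₄ s))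
          ⌢ subst (Covers _ _) (e₆ s) (one (single (#2 (inj₂ (e₅ s)))))
  ; two   = #0 refl
  ; four  = #1 refl
  ; odds  = subst (Covers _ 0) (+-identityʳ s) (map-Covers inInner (nest-odds s (9 + s) 0))
          ⌢ one (single (#2 refl))
          ⌢ one (single (#3 refl))
          ⌢ one (single (#4 refl))
          ⌢ one (single (#5 refl))
          ⌢ subst (Covers _ _) (e₇ s) (map-Covers inOuter (nest-odds s 3 (4 + s)))
  }
  where
  singles inner outer : List Base
  singles = (5 + s , 2) ∷ (4 + s , 4) ∷ (10 + (s + s) , 3 + 2 * s)
          ∷ (6 + s , 3 + 2 * (1 + s)) ∷ (2 , 3 + 2 * (2 + s)) ∷ (3 + s , 3 + 2 * (3 + s)) ∷ []
  inner = nest s (9 + s) 0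
  outer = nest s 3 (4 + s)
  single : ∀ {P : Base → Set} → Any P singles → Any P (singles ++ inner ++ outer)
  single = ++⁺ˡ
  inInner : ∀ {P : Base → Set} → Any P inner → Any P (singles ++ inner ++ outer)
  inInner = ++⁺ʳ singles ∘ ++⁺ˡ
  inOuter : ∀ {P : Base → Set} → Any P outer → Any P (singles ++ inner ++ outer)
  inOuter = ++⁺ʳ singles ∘ ++⁺ʳ inner
  e₀ : ∀ s → 6 + (s + s) ≡ 2 + (4 + 2 * s)
  e₀ = solve-∀
  e₁ : ∀ s → 9 + (s + s) ≡ 3 + 2 * (2 + s) + 2
  e₁ = solve-∀
  e₂ : ∀ s → 11 + (s + s) ≡ 2 + (s + (2 * 0 + (9 + s)))
  e₂ = solve-∀
  e₃ : ∀ s → 11 + (s + s + s) ≡ 3 + 2 * (1 + s) + (6 + s)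
  e₃ = solve-∀
  e₈ : ∀ s → 12 + (s + s + s) ≡ 3 + 2 * (3 + s) + (3 + s)
  e₈ = solve-∀
  e₄ : ∀ s → 13 + (s + s + s) ≡ 2 + (s + (2 * (4 + s) + 3))
  e₄ = solve-∀
  e₅ : ∀ s → 13 + (s + s + s + s) ≡ 3 + 2 * s + (10 + (s + s))
  e₅ = solve-∀
  e₆ : ∀ s → 14 + (s + s + s + s) ≡ 6 + 2 * (4 + 2 * s)
  e₆ = solve-∀
  e₇ : ∀ s → s + (4 + s) ≡ 4 + 2 * s
  e₇ = solve-∀

langford : ∀ k → Langford (1 + k)
langford 0 = langford-1
langford 1 = langford-2
langford (suc (suc k)) with halve k
... | s , inj₁ refl = langford-3+2s s
... | s , inj₂ refl = langford-4+2s s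

-- Surjections between finite sets of equal size.

Fin-surjective⇒injective : ∀ {n} {f : Fin n → Fin n} →
                           StrictlySurjective _≡_ f → Injective _≡_ _≡_ f
Fin-surjective⇒injective {suc n} {f} surj {x} {y} fx≡fy =
  trans (sym (fixed x)) (trans (cong section fx≡fy) (fixed y))
  where
  section : Fin (suc n) → Fin (suc n)
  section = proj₁ ∘ surj

  section-injective : Injective _≡_ _≡_ section
  section-injective {i} {j} eq = trans (sym (proj₂ (surj i))) (trans (cong f eq) (proj₂ (surj j)))

  -- If the injective section missed `x`, removing `x` would squeeze n + 1 values injectively into n
  -- places.
  hit : ∀ x → ¬ (∀ z → x ≢ section z)
  hit x missed with pigeonhole (n<1+n n) (λ z → punchOut (missed z))
  ... | i , j , i<j , eq =
    Fin.<⇒≢ i<j (section-injective (punchOut-injective (missed i) (missed j) eq))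

  -- So the section is a left inverse of `f` too. `hit` only denies that `x` is missed, without
  -- producing a preimage; decidable equality turns this into the equation.
  fixed : ∀ x → section (f x) ≡ x
  fixed x = decidable-stable (section (f x) ≟ x) λ fixed-not → hit x λ z x≡gz →
    fixed-not (trans (cong section (trans (cong f x≡gz) (proj₂ (surj z)))) (sym x≡gz))

surjective⇒injective : ∀ {A B : Set} {n} → A ↔ Fin n → B ↔ Fin n → {f : A → B} →
                       StrictlySurjective _≡_ f → Injective _≡_ _≡_ f
surjective⇒injective α β {f} surj {x} {y} fx≡fy =
  Injection.injective (↔⇒↣ α) (Fin-surjective⇒injective surj′ (cong (to β) (begin
    f (from α (to α x))  ≡⟨ cong f (strictlyInverseʳ α x) ⟩
    f x                  ≡⟨ fx≡fy ⟩
    f y                  ≡⟨ cong f (strictlyInverseʳ α y) ⟨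
    f (from α (to α y))  ∎)))
  where
  open Inverse
  open ≡-Reasoning
  surj′ : StrictlySurjective _≡_ (to β ∘ f ∘ from α)
  surj′ z with surj (from β z)
  ... | a , eq = to α a ,
    trans (cong (to β) (trans (cong f (strictlyInverseʳ α a)) eq)) (strictlyInverseˡ β z)

length-filter-tabulate : ∀ {A : Set} {P : A → Set} (P? : Decidable P) {n} (f : Fin n → A) i →
                         P (f i) → (∀ j → P (f j) → j ≡ i) →
                         length (filter P? (tabulate f)) ≡ 1
length-filter-tabulate P? f zero Pfi unique =
  trans (cong length (filter-accept P? Pfi))
        (cong (suc ∘ length) (filter-none P?
          (All.tabulate⁺ λ j Pfj → Fin.0≢1+n (sym (unique (suc j) Pfj)))))
length-filter-tabulate P? f (suc i) Pfi unique =
  trans (cong length (filter-reject P? λ Pf0 → Fin.0≢1+n (unique zero Pf0)))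
        (length-filter-tabulate P? (f ∘ suc) i Pfi λ j Pfj → Fin.suc-injective (unique (suc j) Pfj))

-- Translations of the cyclic group of order c.

module Cyclic (n : ℕ) where

  c : ℕ
  c = suc n

  infixl 6 _⊕_

  _⊕_ : Fin c → ℕ → Fin c
  i ⊕ a = (toℕ i + a) mod c

  toℕ-⊕ : ∀ i a → toℕ (i ⊕ a) ≡ (toℕ i + a) % c
  toℕ-⊕ i a = toℕ-fromℕ< _

  ⊕-assoc : ∀ i a b → i ⊕ a ⊕ b ≡ i ⊕ (a + b)
  ⊕-assoc i a b = toℕ-injective (begin
    toℕ (i ⊕ a ⊕ b)                    ≡⟨ toℕ-⊕ (i ⊕ a) b ⟩
    (toℕ (i ⊕ a) + b) % c              ≡⟨ cong (λ x → (x + b) % c) (toℕ-⊕ i a) ⟩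
    ((toℕ i + a) % c + b) % c          ≡⟨ %-distribˡ-+ ((toℕ i + a) % c) b c ⟩
    ((toℕ i + a) % c % c + b % c) % c  ≡⟨ cong (λ x → (x + b % c) % c) (m%n%n≡m%n (toℕ i + a) c) ⟩
    ((toℕ i + a) % c + b % c) % c      ≡⟨ %-distribˡ-+ (toℕ i + a) b c ⟨
    (toℕ i + a + b) % c                ≡⟨ cong (_% c) (+-assoc (toℕ i) a b) ⟩
    (toℕ i + (a + b)) % c              ≡⟨ toℕ-⊕ i (a + b) ⟨
    toℕ (i ⊕ (a + b))                  ∎)
    where open ≡-Reasoning

  ⊕-identity : ∀ i → i ⊕ 0 ≡ i
  ⊕-identity i = toℕ-injective (trans (toℕ-⊕ i 0)
    (trans (cong (_% c) (+-identityʳ (toℕ i))) (m<n⇒m%n≡m (toℕ<n i))))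

  ⊕-period : ∀ i k → i ⊕ k * c ≡ i
  ⊕-period i k = toℕ-injective (trans (toℕ-⊕ i (k * c))
    (trans ([m+kn]%n≡m%n (toℕ i) k c) (m<n⇒m%n≡m (toℕ<n i))))

  ⊕-surjective : ∀ a j → ∃[ i ] i ⊕ a ≡ j
  -- Since n is -1 modulo c, translating by `a * n` undoes translating by `a`.
  ⊕-surjective a j = j ⊕ a * n , trans (⊕-assoc j (a * n) a)
    (trans (cong (j ⊕_) (trans (+-comm (a * n) a) (sym (*-suc a n)))) (⊕-period j a))

  ⊕-cancel : ∀ i {a b} → a + b ≡ c → i ⊕ a ⊕ b ≡ i
  ⊕-cancel i {a} {b} a+b≡c = trans (⊕-assoc i a b)
    (trans (cong (i ⊕_) (trans a+b≡c (sym (*-identityˡ c)))) (⊕-period i 1))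

  difference : ∀ i j → ∃[ v ] v < c × i ⊕ v ≡ j
  difference i j = w % c , m%n<n w c , toℕ-injective (begin
    toℕ (i ⊕ w % c)                ≡⟨ toℕ-⊕ i (w % c) ⟩
    (toℕ i + w % c) % c            ≡⟨ %-distribˡ-+ (toℕ i) (w % c) c ⟩
    (toℕ i % c + w % c % c) % c    ≡⟨ cong (λ x → (toℕ i % c + x) % c) (m%n%n≡m%n w c) ⟩
    (toℕ i % c + w % c) % c        ≡⟨ %-distribˡ-+ (toℕ i) w c ⟨
    (toℕ i + w) % c                ≡⟨ cong (_% c) lemma ⟩
    (toℕ j + c) % c                ≡⟨ [m+n]%n≡m%n (toℕ j) c ⟩
    toℕ j % c                      ≡⟨ m<n⇒m%n≡m (toℕ<n j) ⟩
    toℕ j                          ∎)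
    where
    open ≡-Reasoning
    -- A representative of j - i whose truncated subtraction is exact because i < c; it may reach c
    -- or more, hence the remainder above.
    w = (c ∸ toℕ i) + toℕ j
    lemma : toℕ i + w ≡ toℕ j + c
    lemma = trans (sym (+-assoc (toℕ i) (c ∸ toℕ i) (toℕ j)))
              (trans (cong (_+ toℕ j) (m+[n∸m]≡n (<⇒≤ (toℕ<n i)))) (+-comm c (toℕ j)))

-- Sizes of products and sums; contiguity in a torus with three rows.

_×-size_ : ∀ {A B : Set} {m n} → A ↔ Fin m → B ↔ Fin n → (A × B) ↔ Fin (m * n)
α ×-size β = ↔-sym *↔× ↔-∘ (α ×-↔ β)

_⊎-size_ : ∀ {A B : Set} {m n} → A ↔ Fin m → B ↔ Fin n → (A ⊎ B) ↔ Fin (m + n)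
α ⊎-size β = ↔-sym +↔⊎ ↔-∘ (α ⊎-↔ β)

rows : ∀ (x y : Fin 3) → y ≡ x ⊎ y ≡ x ⁺ ⊎ y ≡ x ⁻
rows 0F 0F = inj₁ refl
rows 0F 1F = inj₂ (inj₁ refl)
rows 0F 2F = inj₂ (inj₂ refl)
rows 1F 0F = inj₂ (inj₂ refl)
rows 1F 1F = inj₁ refl
rows 1F 2F = inj₂ (inj₁ refl)
rows 2F 0F = inj₂ (inj₁ refl)
rows 2F 1F = inj₂ (inj₂ refl)
rows 2F 2F = inj₁ refl

⁻-⁺ : ∀ (x : Fin 3) → (x ⁻) ⁺ ≡ x
⁻-⁺ 0F = refl
⁻-⁺ 1F = refl
⁻-⁺ 2F = refl

-- The column offsets 0, 1 and -1 are indexed by `Fin 3` so that near pairs can be counted.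
near : ∀ {c} → Fin c → Fin 3 → Fin c
near y 0F = y
near y 1F = y ⁺
near y 2F = y ⁻

contiguous⇒near : ∀ {c} (p q : Point 3 c) → StronglyContiguous p q →
                  ∃[ b ] near (proj₂ p) b ≡ proj₂ q
contiguous⇒near p q (#0 refl) = 0F , refl
contiguous⇒near p q (#1 refl) = 0F , refl
contiguous⇒near p q (#2 refl) = 2F , refl
contiguous⇒near p q (#3 refl) = 1F , refl
contiguous⇒near p q (#4 refl) = 2F , refl
contiguous⇒near p q (#5 refl) = 1F , refl
contiguous⇒near p q (#6 refl) = 2F , refl
contiguous⇒near p q (#7 refl) = 1F , refl

-- Any two rows modulo 3 are equal or adjacent, so the columns alone decide contiguity of distinct
-- points.
near⇒contiguous : ∀ {c} (x x′ : Fin 3) (y : Fin c) b → (x , y) ≢ (x′ , near y b) →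
                  StronglyContiguous (x , y) (x′ , near y b)
near⇒contiguous x x′ y b p≢q with rows x x′ | b
... | inj₁ refl        | 0F = contradiction refl p≢q
... | inj₁ refl        | 1F = #3 refl
... | inj₁ refl        | 2F = #2 refl
... | inj₂ (inj₁ refl) | 0F = #1 refl
... | inj₂ (inj₁ refl) | 1F = #7 refl
... | inj₂ (inj₁ refl) | 2F = #6 refl
... | inj₂ (inj₂ refl) | 0F = #0 refl
... | inj₂ (inj₂ refl) | 1F = #5 refl
... | inj₂ (inj₂ refl) | 2F = #4 refl

-- The developed blocks and the pairs of points they reach.

module Plan {k} (L : Langford k) where

  open Langford L
  open Cyclic (6 + 2 * k)

  Index : Set
  Index = Fin 3 × Fin c × Fin (length pairs)

  point : Index → Fin 3 → Point 3 c
  point (x , m , t) u with lookup pairs t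
  point (x , m , t) 0F | p , d = x , m
  point (x , m , t) 1F | p , d = x , m ⊕ d
  point (x , m , t) 2F | p , d = x ⁺ , m ⊕ (d + p)

  -- Phrased with two different places of a block, because different places are shown to hold
  -- different points only after the counting.
  Joined : Point 3 c → Point 3 c → Set
  Joined p q = ∃[ B ] ∃[ u ] ∃[ v ] u ≢ v × point B u ≡ p × point B v ≡ q

  Joined-sym : ∀ {p q} → Joined p q → Joined q p
  Joined-sym (B , u , v , u≢v , eq , eq′) = B , v , u , u≢v ∘ sym , eq′ , eq

  -- As c is odd, v and c - v have opposite parity, so the odd differences and their complements
  -- reach everything except 2, 4, c - 4 and c - 2, which the differences 2 and 4 supply.
  differences : Covers (λ v → Any (λ b → Difference v b ⊎ v + proj₂ b ≡ c) pairs) 2 (6 + 2 * k)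
  differences v 2≤v v<c-1 with halve v
  ... | 0 , inj₁ refl = contradiction 2≤v λ ()
  ... | 1 , inj₁ refl = Any.map inj₁ two
  ... | 2 , inj₁ refl = Any.map inj₁ four
  -- An even v = 2(3 + u) has the odd complement c - v = 3 + 2(k - u - 1).
  ... | suc (suc (suc u)) , inj₁ refl =
    Any.map (λ eq → inj₂ (trans (cong (2 * (3 + u) +_) (sym eq)) v+d≡c))
            (odds e z≤n (∸-monoʳ-< (s≤s z≤n) u<k))
    where
    e : ℕ
    e = k ∸ suc u
    double : ∀ u → 2 * (3 + u) ≡ 6 + 2 * u
    double = solve-∀
    u<k : u < k
    u<k = *-cancelˡ-< 2 u k (+-cancelˡ-< 6 (2 * u) (2 * k) (subst (_< 6 + 2 * k) (double u) v<c-1))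
    total : ∀ u e → 2 * (3 + u) + (3 + 2 * e) ≡ 7 + 2 * (e + suc u)
    total = solve-∀
    v+d≡c : 2 * (3 + u) + (3 + 2 * e) ≡ c
    v+d≡c = trans (total u e) (cong (λ k → 7 + 2 * k) (m∸n+n≡m u<k))
  ... | 0 , inj₂ refl = contradiction 2≤v λ { (s≤s ()) }
  -- Here v = 3 + 2e: a listed odd difference if e < k, c - 4 if e = k, c - 2 if e = k + 1, and out
  -- of range beyond.
  ... | suc e , inj₂ refl with <-cmp e k | <-cmp e (1 + k)
  ...   | tri< e<k _ _ | _ = Any.map (λ eq → inj₁ (trans (odd e) eq)) (odds e z≤n e<k)
    where
    odd : ∀ e → 1 + 2 * suc e ≡ 3 + 2 * e
    odd = solve-∀
  ...   | tri≈ _ refl _ | _ = Any.map (λ { refl → inj₂ (total k) }) four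
    where
    total : ∀ e → 1 + 2 * suc e + 4 ≡ 7 + 2 * e
    total = solve-∀
  ...   | tri> _ _ _ | tri≈ _ refl _ = Any.map (λ { refl → inj₂ (total k) }) two
    where
    total : ∀ e → 1 + 2 * suc (suc e) + 2 ≡ 7 + 2 * e
    total = solve-∀
  ...   | tri> _ _ k<e | tri< e<1+k _ _ = contradiction (s≤s⁻¹ e<1+k) (<⇒≱ k<e)
  ...   | tri> _ _ _ | tri> _ _ 1+k<e = contradiction v<c-1 (≤⇒≯ (begin
    6 + 2 * k      ≡⟨ double k ⟩
    2 * (3 + k)    ≤⟨ *-monoʳ-≤ 2 (s≤s 1+k<e) ⟩
    2 * suc e      ≤⟨ n≤1+n _ ⟩
    1 + 2 * suc e  ∎))
    where
    open ≤-Reasoning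
    double : ∀ k → 6 + 2 * k ≡ 2 * (3 + k)
    double = solve-∀

  Far : ℕ → Set
  Far v = 2 ≤ v × v < 6 + 2 * k

  joined-level : ∀ x y {v} → Far v → Joined (x , y) (x , y ⊕ v)
  joined-level x y {v} (2≤v , v<c-1) with differences v 2≤v v<c-1
  ... | any with lookup-index any
  ... | inj₁ v≡d = (x , y , index any) , 0F , 1F , (λ ()) , refl ,
    cong (λ a → x , y ⊕ a) (sym v≡d)
  ... | inj₂ v+d≡c = (x , y ⊕ v , index any) , 1F , 0F , (λ ()) ,
    cong (x ,_) (⊕-cancel y v+d≡c) , refl

  -- Only the third place lies in the next row. An end v = d + p is reached from the first place, an
  -- end v = p from the second, with the block translated so that this place falls on column `y`.
  joined-ahead : ∀ x y {v} → Far v → Joined (x , y) (x ⁺ , y ⊕ v)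
  joined-ahead x y {v} (2≤v , v<c-1) with ends v 2≤v v<c-1
  ... | any with lookup-index any
  ... | inj₂ v≡d+p = (x , y , index any) , 0F , 2F , (λ ()) , refl ,
    cong (λ a → x ⁺ , y ⊕ a) (sym v≡d+p)
  ... | inj₁ v≡p with ⊕-surjective (proj₂ (lookup pairs (index any))) y
  ...   | m , refl = (x , m , index any) , 1F , 2F , (λ ()) , refl ,
    cong (x ⁺ ,_) (trans (cong (λ a → m ⊕ (proj₂ (lookup pairs (index any)) + a)) (sym v≡p))
                         (sym (⊕-assoc m _ v)))

  complement : ∀ {v} → Far v → ∃[ w ] Far w × v + w ≡ c
  complement {v} (2≤v , v<c-1) = c ∸ v ,
    (m+n≤o⇒m≤o∸n 2 (s≤s v<c-1) , ∸-monoʳ-< 2≤v (≤-trans (<⇒≤ v<c-1) (n≤1+n _))) ,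
    m+[n∸m]≡n (≤-trans (<⇒≤ v<c-1) (n≤1+n _))

  joined : ∀ x x′ y {v} → Far v → Joined (x , y) (x′ , y ⊕ v)
  joined x x′ y {v} far with rows x x′
  ... | inj₁ refl = joined-level x y far
  ... | inj₂ (inj₁ refl) = joined-ahead x y far
  -- One row back is one row ahead read in reverse, with offset c - v.
  ... | inj₂ (inj₂ refl) with complement far
  ...   | w , far′ , v+w≡c =
    Joined-sym (subst (Joined _) (cong₂ _,_ (⁻-⁺ x) (⊕-cancel y v+w≡c))
                      (joined-ahead (x ⁻) (y ⊕ v) far′))

  near-or-joined : ∀ (p q : Point 3 c) → (∃[ b ] near (proj₂ p) b ≡ proj₂ q) ⊎ Joined p q
  near-or-joined (x , y) (x′ , y′) with difference y y′
  ... | 0 , _ , refl = inj₁ (0F , sym (⊕-identity y))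
  ... | 1 , _ , refl = inj₁ (1F , refl)
  ... | v@(suc (suc _)) , v<c , refl with m≤n⇒m<n∨m≡n (s≤s⁻¹ v<c)
  ...   | inj₁ v<c-1 = inj₂ (joined x x′ y (s≤s (s≤s z≤n) , v<c-1))
  -- Here v = 6 + 2k = c - 1, which is how `_⁻` represents -1.
  ...   | inj₂ refl = inj₁ (2F , refl)

  -- Counting flags against ordered pairs of points.

  Flag : Set
  Flag = (Index × Fin 3 × Fin 2) ⊎ (Point 3 c × Fin 3 × Fin 3)

  -- For a block the second place is named by its rank among the two places other than `u`, so a
  -- block has exactly 6 flags; a point has 9 near flags, one for each row and offset.
  ends-of : Flag → Point 3 c × Point 3 c
  ends-of (inj₁ (B , u , w)) = point B u , point B (punchIn u w)
  ends-of (inj₂ ((x , y) , x′ , b)) = (x , y) , (x′ , near y b)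

  flag : ∀ {u v} → Index → u ≢ v → Flag
  flag {u} B u≢v = inj₁ (B , u , punchOut u≢v)

  ends-of-flag : ∀ {u v} B (u≢v : u ≢ v) → ends-of (flag B u≢v) ≡ (point B u , point B v)
  ends-of-flag {u} B u≢v = cong (λ v → point B u , point B v) (Fin.punchIn-punchOut u≢v)

  ends-of-surjective : StrictlySurjective _≡_ ends-of
  ends-of-surjective (p@(x , y) , q@(x′ , y′)) with near-or-joined p q
  ... | inj₁ (b , refl) = inj₂ (p , x′ , b) , refl
  ... | inj₂ (B , u , v , u≢v , eq , eq′) = flag B u≢v ,
    trans (ends-of-flag B u≢v) (cong₂ _,_ eq eq′)

  point-size : Point 3 c ↔ Fin (3 * c)
  point-size = ↔-id _ ×-size ↔-id _

  index-size : Index ↔ Fin (3 * (c * length pairs))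
  index-size = ↔-id _ ×-size (↔-id _ ×-size ↔-id _)

  -- There are 3c(2 + k) blocks, and 6(2 + k) + 9 = 3(7 + 2k) = 3c, so the total is 3c · 3c.
  flag-size : Flag ↔ Fin (3 * c * (3 * c))
  flag-size = subst (λ m → Flag ↔ Fin m)
    (trans (cong (λ l → 3 * (c * l) * 6 + 3 * c * 9) size) (count k))
    ((index-size ×-size (↔-id _ ×-size ↔-id _))
      ⊎-size (point-size ×-size (↔-id _ ×-size ↔-id _)))
    where
    count : ∀ k → 3 * ((7 + 2 * k) * (2 + k)) * 6 + 3 * (7 + 2 * k) * 9
                  ≡ 3 * (7 + 2 * k) * (3 * (7 + 2 * k))
    count = solve-∀

  ends-of-injective : Injective _≡_ _≡_ ends-of
  ends-of-injective = surjective⇒injective flag-size (point-size ×-size point-size) ends-of-surjective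

  -- Otherwise a block flag and a near flag would have the same ends, yet they lie in different
  -- summands of `Flag`.
  not-near : ∀ B {u v} → u ≢ v → ∀ b → near (proj₂ (point B u)) b ≢ proj₂ (point B v)
  not-near B {u} {v} u≢v b eq = contradiction
    (ends-of-injective {flag B u≢v} {inj₂ (point B u , proj₁ (point B v) , b)}
      (trans (ends-of-flag B u≢v) (cong (λ y → point B u , proj₁ (point B v) , y) (sym eq))))
    λ ()

  point-injective : ∀ B {u v} → point B u ≡ point B v → u ≡ v
  point-injective B {u} {v} eq with u ≟ v
  ... | yes u≡v = u≡v
  -- Coinciding points would be near with column offset 0.
  ... | no  u≢v = contradiction (cong proj₂ eq) (not-near B u≢v 0F)

  -- The blocks and the verification of the two conditions.

  toBlock : Index → Block 3 c 3
  toBlock B = block (Vec.tabulate (point B)) (tabulate⁺ (point-injective B))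

  position : ∀ B {p} → p Vec.∈ elements (toBlock B) → ∃[ u ] point B u ≡ p
  position B p∈ with VecAny.tabulate⁻ p∈
  ... | u , eq = u , sym eq

  positions-differ : ∀ B {p q} → p ≢ q → AppearTogether p q (toBlock B) →
               ∃[ u ] ∃[ v ] u ≢ v × point B u ≡ p × point B v ≡ q
  positions-differ B p≢q (p∈ , q∈) with position B p∈ | position B q∈
  ... | u , refl | v , refl = u , v , (λ { refl → p≢q refl }) , refl , refl

  blocks : List (Block 3 c 3)
  blocks = tabulate (toBlock ∘ Inverse.from index-size)

  is-2-BSA-IS : Is2-BSA-IS 3 c 3 1 blocks
  is-2-BSA-IS = record { avoiding = avoiding ; balanced = balanced }
    where
    avoiding : ∀ p q → p ≢ q → StronglyContiguous p q →
               All (λ B → ¬ AppearTogether p q B) blocks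
    avoiding p q p≢q contiguous = All.tabulate⁺ λ i → avoid (Inverse.from index-size i)
      where
      avoid : ∀ B → ¬ AppearTogether p q (toBlock B)
      avoid B together with positions-differ B p≢q together | contiguous⇒near p q contiguous
      ... | u , v , u≢v , refl , refl | b , eq = not-near B u≢v b eq

    joined⇒balanced : ∀ {p q} → p ≢ q → Joined p q →
                      length (filter (appearTogether? p q) blocks) ≡ 1
    joined⇒balanced {p} {q} p≢q (B , u , v , u≢v , refl , refl) =
      length-filter-tabulate (appearTogether? p q) (toBlock ∘ Inverse.from index-size)
        (Inverse.to index-size B)
        (subst (AppearTogether p q ∘ toBlock) (sym (Inverse.strictlyInverseʳ index-size B))
          (∈-tabulate⁺ (point B) u , ∈-tabulate⁺ (point B) v))
        λ j together → trans (sym (Inverse.strictlyInverseˡ index-size j))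
                             (cong (Inverse.to index-size) (unique (Inverse.from index-size j) together))
      where
      index-of : Flag → Index
      index-of (inj₁ (B , _)) = B
      index-of (inj₂ _)       = B

      -- Both blocks yield a flag with ends `p` and `q`; injectivity identifies the flags, hence
      -- their blocks.
      unique : ∀ B′ → AppearTogether p q (toBlock B′) → B′ ≡ B
      unique B′ together with positions-differ B′ p≢q together
      ... | u′ , v′ , u′≢v′ , eqᵤ , eqᵥ =
        cong index-of (ends-of-injective {flag B′ u′≢v′} {flag B u≢v}
          (trans (ends-of-flag B′ u′≢v′) (trans (cong₂ _,_ eqᵤ eqᵥ) (sym (ends-of-flag B u≢v)))))

    balanced : ∀ p q → p ≢ q → ¬ StronglyContiguous p q →
               length (filter (appearTogether? p q) blocks) ≡ 1
    balanced p@(x , y) q@(x′ , y′) p≢q ¬contiguous =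
      [ (λ { (b , refl) → contradiction (near⇒contiguous x x′ y b p≢q) ¬contiguous })
      , joined⇒balanced p≢q ]′ (near-or-joined p q)

theorem4p4 : ∀ (c : ℕ) → c % 2 ≡ 1 → c ≥ 9 →
    ∃[ blocks ] Is2-BSA-IS 3 c 3 1 blocks
theorem4p4 c c%2≡1 c≥9 with halve c
... | h , inj₁ refl = contradiction
    (trans (sym (trans (cong (_% 2) (*-comm 2 h)) (m*n%n≡0 h 2))) c%2≡1) λ ()
-- Here c = 9 + 2k, which is 7 + 2(1 + k), so the sequence of parameter 1 + k is the one to develop.
... | suc (suc (suc (suc k))) , inj₂ refl =
  subst (λ c → ∃[ blocks ] Is2-BSA-IS 3 c 3 1 blocks) (lemma k) (_ , Plan.is-2-BSA-IS (langford k))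
  where
  lemma : ∀ k → 7 + 2 * (1 + k) ≡ 1 + 2 * (4 + k)
  lemma = solve-∀
... | 0 , inj₂ refl = contradiction c≥9 (from-no (9 ≤? 1))
... | 1 , inj₂ refl = contradiction c≥9 (from-no (9 ≤? 3))
... | 2 , inj₂ refl = contradiction c≥9 (from-no (9 ≤? 5))
... | 3 , inj₂ refl = contradiction c≥9 (from-no (9 ≤? 7))
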